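{- Let $\mathcal{G}=(V,\mathcal{E})$ be a plurigraph with $V=[n]$. Then $$Y_{\mathcal{G}}=\sum_{A\subseteq\mathcal{E}}(-1)^{|A|}p_{\pi(A)},$$ where the sum is over all sub-multisets $A$ of $\mathcal{E}$ (the elements of $\mathcal{E}$ being regarded as distinct, so there are $2^{|\mathcal{E}|}$ terms).
   Context: Work over a field $\mathbb{K}$ of characteristic zero with noncommuting variables $y_1,y_2,\dots$, $\mathbb{P}=\{1,2,\dots\}$. A graph $(V,E)$ has $E$ a finite multiset of unordered pairs of (not necessarily distinct) vertices. A plurigraph is $\mathcal{G}=(V,\mathcal{E})$ with $\mathcal{E}$ a finite multiset of graphs $(V,E)$ on vertex set $V$ with $E\ne\emptyset$. A proper coloring is $f:V\to\mathbb{P}$ such that each $(V,E)\in\mathcal{E}$ has an edge $uv\in E$ with $f(u)\ne f(v)$; $Y_{\mathcal{G}}=\sum_f y_{f(1)}\cdots y_{f(n)}$ over proper colorings. For a set partition $\pi$ of $[n]$, $m_\pi=\sum y_{i_1}\cdots y_{i_n}$ over sequences $(i_1,\dots,i_n)\in\mathbb{P}^n$ with $i_j=i_k$ iff $j,k$ lie in the same block of $\pi$, and $p_\pi=\sum_{\sigma\ge\pi}m_\sigma$, the sum over set partitions $\sigma$ of $[n]$ coarser than or equal to $\pi$. For $A=\{(V,E_1),\dots,(V,E_k)\}\subseteq\mathcal{E}$, $\pi(A)$ is the partition of $V$ into connected components of the graph $(V,\bigcup_{i}E_i)$ (for $A=\emptyset$ this is the partition into singletons). -}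

module Defs where

open import Level using (Level)
open import Algebra.Apartness.Bundles using (HeytingField; HeytingCommutativeRing)
open import Algebra.Bundles using (CommutativeRing)
import Algebra.Properties.Monoid.Mult as Mult
import Algebra.Properties.Semiring.Exp as Exp
open import Data.Bool.Base using (true; if_then_else_)
open import Data.Bool.Properties as Bool using ()
open import Data.Fin.Base using (Fin)
import Data.Fin.Properties as Fin
open import Data.Fin.Subset using (Subset; inside; outside; _∈_; _⊆_)
open import Data.Fin.Subset.Properties using (_∈?_; _⊆?_)
open import Data.List.Base as List using (List; []; _∷_; length)
open import Data.List.Membership.Propositional using () renaming (_∈_ to _∈ˡ_)
open import Data.List.Relation.Unary.All as All using (All)
open import Data.List.Relation.Unary.Any as Any using (Any; here; there)
import Data.Maybe.Base as Maybe
open import Data.Nat.Base using (ℕ; zero; suc; NonZero)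
import Data.Nat.Properties as ℕ
open import Data.Product.Base using (∃; _×_; _,_; uncurry)
open import Data.Refinement as Refinement using (Refinement-syntax)
open import Data.Sum.Base using (_⊎_; inj₁; inj₂)
open import Data.Vec.Base as Vec using (Vec; []; _∷_; lookup; tabulate; toList; fromList)
import Data.Vec.Properties as Vec
open import Function.Bundles using (_⇔_; mk⇔; Equivalence)
open import Relation.Binary.Construct.Closure.Equivalence as EqC using (EqClosure)
open import Relation.Binary.Construct.Closure.ReflexiveTransitive using (ε; _◅_)
open import Relation.Binary.Construct.Closure.Symmetric using (fwd; bwd)
import Relation.Binary.Definitions as B
open import Relation.Binary.PropositionalEquality
  using (_≡_; _≢_; refl; sym; trans; cong; subst)
open import Relation.Nullary.Decidable
  using (Dec; yes; no; does; map′; _×-dec_; _⊎-dec_; _→-dec_; ¬?; dec⇒maybe; dec-true; does-⇔)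
open import Relation.Nullary.Negation using (¬_)
open import Relation.Unary using (Pred; Decidable)

private
  variable
    a ℓ : Level
    n : ℕ

ℙ : Set
ℙ = [ i ∈ ℕ ∣ NonZero i ]

_≟ℙ_ : B.DecidableEquality ℙ
_≟ℙ_ = Refinement._≟_ ℕ._≟_

-- Lists all vectors over the alphabet xs, each once if xs has no repetitions.
vectors : {A : Set a} → List A → (n : ℕ) → List (Vec A n)
vectors xs zero    = [] ∷ []
vectors xs (suc n) = List.concatMap (λ x → List.map (x ∷_) (vectors xs n)) xs

subsets : (n : ℕ) → List (Subset n)
subsets = vectors (outside ∷ inside ∷ [])

-- Graphs and plurigraphs on the vertex set [n], the latter being Fin n.
-- Finite multisets are lists; no definition below depends on the order of
-- the list or on the order of the two ends of an edge.

record Graph (n : ℕ) : Set where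
  constructor graph
  field
    edges : List (Fin n × Fin n)

open Graph public

record Plurigraph (n : ℕ) : Set where
  field
    graphs   : List (Graph n)
    nonEmpty : All (λ g → edges g ≢ []) graphs

  size : ℕ
  size = length graphs

open Plurigraph public

-- A coloring f of [n] is the vector (f(1), …, f(n)).
Coloring : ℕ → Set
Coloring = Vec ℙ

Proper : Plurigraph n → Pred (Coloring n) _
Proper G f = All (λ g → Any (λ (u , v) → lookup f u ≢ lookup f v) (edges g)) (graphs G)

proper? : (G : Plurigraph n) → Decidable (Proper G)
proper? G f =
  All.all? (λ g → Any.any? (λ (u , v) → ¬? (lookup f u ≟ℙ lookup f v)) (edges g)) (graphs G)

-- A set partition is given by the block of each element, so that its blocks
-- are the distinct entries of the vector.  The conditions say that these
-- blocks cover [n] and that two blocks with a common element coincide.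

IsSetPartition : Vec (Subset n) n → Set
IsSetPartition bs =
  (∀ i → i ∈ lookup bs i) ×
  (∀ i j → j ∈ lookup bs i → lookup bs j ≡ lookup bs i)

isSetPartition? : Decidable (IsSetPartition {n})
isSetPartition? bs =
  Fin.all? (λ i → i ∈? lookup bs i) ×-dec
  Fin.all? (λ i → Fin.all? (λ j →
    (j ∈? lookup bs i) →-dec Vec.≡-dec Bool._≟_ (lookup bs j) (lookup bs i)))

record SetPartition (n : ℕ) : Set where
  constructor setPartition
  field
    blocks         : Vec (Subset n) n
    isSetPartition : IsSetPartition blocks

  blockOf : Fin n → Subset n
  blockOf = lookup blocks

open SetPartition public

SameBlock : SetPartition n → Fin n → Fin n → Set
SameBlock π i j = j ∈ blockOf π i

-- π ≤ σ: every block of π is contained in a block of σ.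
_≤_ : SetPartition n → SetPartition n → Set
π ≤ σ = ∀ i → blockOf π i ⊆ blockOf σ i

_≤?_ : B.Decidable (_≤_ {n})
π ≤? σ = Fin.all? (λ i → blockOf π i ⊆? blockOf σ i)

-- Each set partition of [n] is listed exactly once.
setPartitions : (n : ℕ) → List (SetPartition n)
setPartitions n = List.mapMaybe
  (λ bs → Maybe.map (setPartition bs) (dec⇒maybe (isSetPartition? bs)))
  (vectors (subsets n) n)

HasPattern : SetPartition n → Pred (Coloring n) _
HasPattern π f = ∀ j k → lookup f j ≡ lookup f k ⇔ SameBlock π j k

hasPattern? : (π : SetPartition n) → Decidable (HasPattern π)
hasPattern? π f = Fin.all? λ j → Fin.all? λ k →
  let eq? = lookup f j ≟ℙ lookup f k ; same? = k ∈? blockOf π j in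
  map′ (uncurry mk⇔) (λ e → Equivalence.to e , Equivalence.from e)
    ((eq? →-dec same?) ×-dec (same? →-dec eq?))

Connected : Graph n → Fin n → Fin n → Set
Connected g = EqClosure (λ u v → (u , v) ∈ˡ edges g)

-- Decided by adding one edge ab at a time: a path using ab can be shortened
-- to use it only once.
connected? : (g : Graph n) → B.Decidable (Connected g)
connected? (graph []) u v = map′ (λ { refl → ε }) equal (u Fin.≟ v)
  where
  equal : ∀ {u v} → Connected (graph []) u v → u ≡ v
  equal ε            = refl
  equal (fwd () ◅ _)
  equal (bwd () ◅ _)
connected? (graph ((a , b) ∷ es)) u v =
  map′ to from (u ∼? v ⊎-dec ((u ∼? a ×-dec b ∼? v) ⊎-dec (u ∼? b ×-dec a ∼? v)))
  where
  _∼_ = Connected (graph es)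
  _∼?_ = connected? (graph es)
  _≈_ = Connected (graph ((a , b) ∷ es))

  Split : Fin _ → Fin _ → Set
  Split u v = u ∼ v ⊎ ((u ∼ a × b ∼ v) ⊎ (u ∼ b × a ∼ v))

  weaken : ∀ {u v} → u ∼ v → u ≈ v
  weaken = EqC.map there

  tr : ∀ {u v w} → u ≈ v → v ≈ w → u ≈ w
  tr = EqC.transitive _

  ab : a ≈ b
  ab = fwd (here refl) ◅ ε

  to : ∀ {u v} → Split u v → u ≈ v
  to (inj₁ p)              = weaken p
  to (inj₂ (inj₁ (p , q))) = tr (weaken p) (tr ab (weaken q))
  to (inj₂ (inj₂ (p , q))) = tr (weaken p) (tr (EqC.symmetric _ ab) (weaken q))

  prepend : ∀ {u v w} → u ∼ v → Split v w → Split u w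
  prepend r (inj₁ p)              = inj₁ (EqC.transitive _ r p)
  prepend r (inj₂ (inj₁ (p , q))) = inj₂ (inj₁ (EqC.transitive _ r p , q))
  prepend r (inj₂ (inj₂ (p , q))) = inj₂ (inj₂ (EqC.transitive _ r p , q))

  from-a : ∀ {w} → Split b w → Split a w
  from-a (inj₁ p)              = inj₂ (inj₁ (ε , p))
  from-a (inj₂ (inj₁ (_ , q))) = inj₂ (inj₁ (ε , q))
  from-a (inj₂ (inj₂ (_ , q))) = inj₁ q

  from-b : ∀ {w} → Split a w → Split b w
  from-b (inj₁ p)              = inj₂ (inj₂ (ε , p))
  from-b (inj₂ (inj₁ (_ , q))) = inj₁ q
  from-b (inj₂ (inj₂ (_ , q))) = inj₂ (inj₂ (ε , q))

  from : ∀ {u v} → u ≈ v → Split u v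
  from ε                       = inj₁ ε
  from (fwd (here refl) ◅ ps)  = from-a (from ps)
  from (bwd (here refl) ◅ ps)  = from-b (from ps)
  from (fwd (there e)   ◅ ps)  = prepend (fwd e ◅ ε) (from ps)
  from (bwd (there e)   ◅ ps)  = prepend (bwd e ◅ ε) (from ps)

component : Graph n → Fin n → Subset n
component g u = tabulate (λ v → does (connected? g u v))

components : Graph n → SetPartition n
components {n} g = setPartition (tabulate (component g)) (covers , coherent)
  where
  lk : ∀ i → lookup (tabulate (component g)) i ≡ component g i
  lk = Vec.lookup∘tabulate (component g)

  ∈⇒connected : ∀ {i j} → j ∈ component g i → Connected g i j
  ∈⇒connected {i} {j} j∈ = extract (connected? g i j)
    (trans (sym (Vec.lookup∘tabulate _ j)) (Vec.[]=⇒lookup j∈))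
    where
    extract : {P : Set} (d : Dec P) → does d ≡ true → P
    extract (yes p) _ = p

  covers : ∀ i → i ∈ lookup (tabulate (component g)) i
  covers i = subst (i ∈_) (sym (lk i)) (Vec.lookup⇒[]= i (component g i)
    (trans (Vec.lookup∘tabulate _ i) (dec-true (connected? g i i) ε)))

  coherent : ∀ i j → j ∈ lookup (tabulate (component g)) i →
             lookup (tabulate (component g)) j ≡ lookup (tabulate (component g)) i
  coherent i j j∈ = trans (lk j) (trans (Vec.tabulate-cong same) (sym (lk i)))
    where
    i∼j : Connected g i j
    i∼j = ∈⇒connected (subst (j ∈_) (lk i) j∈)

    same : ∀ k → does (connected? g j k) ≡ does (connected? g i k)
    same k = does-⇔
      (mk⇔ (EqC.transitive _ i∼j) (EqC.transitive _ (EqC.symmetric _ i∼j)))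
      (connected? g j k) (connected? g i k)

-- The members of the multiset of graphs are told apart by their position, so
-- its sub-multisets are the subsets of Fin (size G).
union : (G : Plurigraph n) → Subset (size G) → Graph n
union G A = graph (List.concatMap (λ i → edges (List.lookup (graphs G) i))
                                  (List.filter (_∈? A) (List.allFin (size G))))

π : (G : Plurigraph n) → Subset (size G) → SetPartition n
π G A = components (union G A)

-- w is the word f(1) … f(n) of a coloring f satisfying P.
Occurs : Pred (Coloring n) ℓ → List ℙ → Set ℓ
Occurs P w = ∃ λ f → P f × toList f ≡ w

occurs? : {P : Pred (Coloring n) ℓ} → Decidable P → Decidable (Occurs P)
occurs? {n} P? w with length w ℕ.≟ n
... | no len≢n = no λ { (f , _ , refl) → len≢n (Vec.length-toList f) }
... | yes refl = map′ (λ p → fromList w , p , Vec.toList∘fromList w) unique (P? (fromList w))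
  where
  unique : Occurs _ w → _
  unique (f , p , eq) = subst _
    (trans (sym (Vec.cast-is-id refl f))
      (Vec.toList-injective refl f (fromList w) (trans eq (sym (Vec.toList∘fromList w))))) p

module Over {c ℓ₁ ℓ₂} (K : HeytingField c ℓ₁ ℓ₂) where

  open HeytingField K hiding (zero; refl; sym; trans)

  private
    commutativeRing : CommutativeRing c ℓ₁
    commutativeRing = HeytingCommutativeRing.commutativeRing heytingCommutativeRing

  open Exp (CommutativeRing.semiring commutativeRing) public using (_^_)
  open Mult (CommutativeRing.+-monoid commutativeRing) using () renaming (_×_ to _×ᴷ_)

  CharacteristicZero : Set ℓ₁
  CharacteristicZero = ∀ k .{{_ : NonZero k}} → ¬ (k ×ᴷ 1# ≈ 0#)

  -- Formal power series in the noncommuting variables y₁, y₂, …: the word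
  -- i₁ … i_d is sent to the coefficient of y_{i₁} ⋯ y_{i_d}.
  Series : Set c
  Series = List ℙ → Carrier

  infix 4 _≋_
  _≋_ : Series → Series → Set ℓ₁
  F ≋ F′ = ∀ w → F w ≈ F′ w

  infixr 7 _·_
  _·_ : Carrier → Series → Series
  (x · F) w = x * F w

  ∑ : {A : Set a} → List A → (A → Series) → Series
  ∑ xs F w = List.foldr _+_ 0# (List.map (λ x → F x w) xs)

  -- The sum of y_{f(1)} ⋯ y_{f(n)} over all f : [n] → ℙ satisfying P.
  -- Distinct f give distinct monomials, so all coefficients are 0 or 1.
  ∑y : {P : Pred (Coloring n) ℓ} → Decidable P → Series
  ∑y P? w = if does (occurs? P? w) then 1# else 0#

  Y : Plurigraph n → Series
  Y G = ∑y (proper? G)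

  m : SetPartition n → Series
  m π = ∑y (hasPattern? π)

  p : SetPartition n → Series
  p {n} π = ∑ (List.filter (π ≤?_) (setPartitions n)) m

{-# OPTIONS --safe #-}
-- The coefficient of the word of a coloring f in p_π is 1 if π refines the
-- kernel of f (the partition of [n] into the color classes) and 0 otherwise,
-- because the kernel is the only partition σ for which f occurs in m_σ.
-- Moreover π(A) refines the kernel of f exactly when A is contained in the set
-- S of the members of 𝓔 that are monochromatic under f.  So the coefficient of
-- the right-hand side is the sum of (-1)^|A| over A ⊆ S, which is 1 if S is
-- empty, that is if f is proper, and 0 otherwise.
module Submission where

open import Algebra.Apartness.Bundles using (HeytingField; HeytingCommutativeRing)
open import Algebra.Bundles using (CommutativeRing)
import Algebra.Properties.Ring as RingProperties
import Algebra.Properties.Semiring.Exp as Exp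
open import Data.Bool.Base using (Bool; true; false; if_then_else_)
open import Data.Fin.Base using (Fin; zero; suc)
open import Data.Fin.Subset
  using (Subset; inside; outside; _∈_; _⊆_; ∣_∣; Empty)
open import Data.Fin.Subset.Properties
  using (⊆-antisym; _⊆?_; nonempty?; out⊆-⇔; in⊆in-⇔; drop-there)
open import Data.List.Base as List
  using (List; []; _∷_; _++_; cartesianProductWith)
open import Data.List.Membership.Propositional using (find; lose) renaming (_∈_ to _∈ˡ_)
open import Data.List.Membership.Propositional.Properties
  using (∈-cartesianProductWith⁺; ∈-concatMap⁺; ∈-concatMap⁻; ∈-filter⁺;
         ∈-filter⁻; ∈-allFin; ∈-lookup)
open import Data.List.Properties using (++-identityʳ)
open import Data.List.Relation.Unary.All as All using (All; []; _∷_)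
open import Data.List.Relation.Unary.All.Properties using (¬All⇒Any¬; Any¬⇒¬All)
open import Data.List.Relation.Unary.AllPairs using ([]; _∷_)
open import Data.List.Relation.Unary.Any as Any using (here; there)
open import Data.List.Relation.Unary.Any.Properties using (lookup-index)
open import Data.List.Relation.Unary.Unique.Propositional using (Unique)
open import Data.List.Relation.Unary.Unique.Propositional.Properties
  using (cartesianProductWith⁺)
open import Data.Maybe.Base as Maybe using (Maybe; just; nothing; maybe′)
open import Data.Nat.Base using (ℕ; zero; suc)
import Data.Nat.Properties as ℕ
open import Data.Product.Base using (_,_; proj₂)
open import Data.Vec.Base as Vec using (Vec; []; _∷_; lookup; tabulate; toList; fromList)
open import Data.Vec.Properties as Vec
  using (lookup∘tabulate; tabulate∘lookup; tabulate-cong; []=⇒lookup; lookup⇒[]=)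
open import Function.Base using (_∘_)
open import Function.Bundles using (_⇔_; mk⇔; Equivalence)
open import Function.Construct.Composition using (_⇔-∘_)
open import Function.Construct.Symmetry using (⇔-sym)
open import Level using (Level)
import Relation.Binary.Construct.Closure.Equivalence as EqC
open import Relation.Binary.Construct.Closure.ReflexiveTransitive using (ε; _◅_)
open import Relation.Binary.Construct.Closure.Symmetric using (fwd)
open import Relation.Binary.PropositionalEquality as ≡
  using (_≡_; _≢_; refl; sym; trans; cong; subst)
open import Relation.Nullary.Decidable
  using (Dec; yes; no; does; ¬?; dec⇒maybe; dec-true; dec-false; does-⇔)
open import Relation.Nullary.Negation using (¬_; contradiction)
open import Relation.Unary using (Pred; Decidable)
open import Defs

private
  variable
    a ℓ : Level
    A B : Set a
    n : ℕ

-- Enumeration of vectors and subsets.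

vectors-suc : (xs : List A) (n : ℕ) →
              vectors xs (suc n) ≡ cartesianProductWith _∷_ xs (vectors xs n)
vectors-suc {A = A} xs n = go xs
  where
  go : (ys : List A) → List.concatMap (λ y → List.map (y ∷_) (vectors xs n)) ys
                       ≡ cartesianProductWith _∷_ ys (vectors xs n)
  go []       = refl
  go (y ∷ ys) = cong (_ ++_) (go ys)

-- A nonempty vector determines its head and its tail, so `_∷_` creates no repetition in a cartesian
-- product of repetition-free lists.
vectors-unique : {xs : List A} → Unique xs → ∀ n → Unique (vectors xs n)
vectors-unique xs! zero = [] ∷ []
vectors-unique {xs = xs} xs! (suc n) = subst Unique (sym (vectors-suc xs n))
  (cartesianProductWith⁺ _∷_ Vec.∷-injective xs! (vectors-unique xs! n))

∈-vectors : {xs : List A} → (∀ x → x ∈ˡ xs) → (v : Vec A n) → v ∈ˡ vectors xs n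
∈-vectors full [] = here refl
∈-vectors {n = suc n} {xs = xs} full (x ∷ v) =
  subst (_ ∈ˡ_) (sym (vectors-suc xs n))
    (∈-cartesianProductWith⁺ _∷_ (full x) (∈-vectors full v))

subsets-unique : ∀ n → Unique (subsets n)
subsets-unique = vectors-unique (((λ ()) ∷ []) ∷ [] ∷ [])

∈-subsets : (A : Subset n) → A ∈ˡ subsets n
∈-subsets = ∈-vectors λ { outside → here refl ; inside → there (here refl) }

lookup-ext : {xs ys : Vec A n} → (∀ i → lookup xs i ≡ lookup ys i) → xs ≡ ys
lookup-ext {xs = xs} {ys} eq =
  trans (sym (tabulate∘lookup xs)) (trans (tabulate-cong eq) (tabulate∘lookup ys))

-- Kernels of colorings and blocks of partitions.

⟦_⟧ : {P : Pred (Fin n) ℓ} → Decidable P → Subset n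
⟦ P? ⟧ = tabulate (does ∘ P?)

∈⟦⟧⇔ : {P : Pred (Fin n) ℓ} (P? : Decidable P) {i : Fin n} → i ∈ ⟦ P? ⟧ ⇔ P i
∈⟦⟧⇔ {P = P} P? {i} = mk⇔
  (λ i∈ → extract (P? i) (trans (sym (lookup∘tabulate _ i)) ([]=⇒lookup i∈)))
  (λ p → lookup⇒[]= i _ (trans (lookup∘tabulate _ i) (dec-true (P? i) p)))
  where
  extract : (d : Dec (P i)) → does d ≡ true → P i
  extract (yes p) _ = p

colorClass : Coloring n → Fin n → Subset n
colorClass f i = ⟦ (λ j → lookup f i ≟ℙ lookup f j) ⟧

kernel : Coloring n → SetPartition n
kernel {n} f = setPartition (tabulate (colorClass f)) (covers , coherent)
  where
  lk : ∀ i → lookup (tabulate (colorClass f)) i ≡ colorClass f i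
  lk = lookup∘tabulate (colorClass f)

  covers : ∀ i → i ∈ lookup (tabulate (colorClass f)) i
  covers i = subst (i ∈_) (sym (lk i))
    (Equivalence.from (∈⟦⟧⇔ (λ j → lookup f i ≟ℙ lookup f j)) refl)

  coherent : ∀ i j → j ∈ lookup (tabulate (colorClass f)) i →
             lookup (tabulate (colorClass f)) j ≡ lookup (tabulate (colorClass f)) i
  -- The class of a vertex depends on the vertex only through its color.
  coherent i j j∈ = trans (lk j) (trans
    (cong (λ x → tabulate λ k → does (x ≟ℙ lookup f k)) (sym fi≡fj)) (sym (lk i)))
    where
    fi≡fj : lookup f i ≡ lookup f j
    fi≡fj = Equivalence.to (∈⟦⟧⇔ (λ k → lookup f i ≟ℙ lookup f k))
      (subst (j ∈_) (lk i) j∈)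

sameBlock-kernel : (f : Coloring n) {i j : Fin n} →
                   SameBlock (kernel f) i j ⇔ lookup f i ≡ lookup f j
sameBlock-kernel f {i} {j} = subst (λ B → j ∈ B ⇔ lookup f i ≡ lookup f j)
  (sym (lookup∘tabulate (colorClass f) i)) (∈⟦⟧⇔ (λ k → lookup f i ≟ℙ lookup f k))

sameBlock-components : (g : Graph n) {i j : Fin n} →
                       SameBlock (components g) i j ⇔ Connected g i j
sameBlock-components g {i} {j} = subst (λ B → j ∈ B ⇔ Connected g i j)
  (sym (lookup∘tabulate (component g) i)) (∈⟦⟧⇔ (connected? g i))

hasPattern-kernel : (f : Coloring n) → HasPattern (kernel f) f
hasPattern-kernel f j k = ⇔-sym (sameBlock-kernel f {j} {k})

-- The pattern forces the block of `i` to be the set of positions that share the color of `i`. Only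
-- `blocks` are compared: equality of the records would also involve their proofs of
-- `IsSetPartition`.
hasPattern⇒kernel : (σ : SetPartition n) (f : Coloring n) →
                    HasPattern σ f → blocks σ ≡ blocks (kernel f)
hasPattern⇒kernel σ f pat = lookup-ext λ i → ⊆-antisym
  (λ {j} j∈ → Equivalence.from (sameBlock-kernel f {i} {j}) (Equivalence.from (pat i j) j∈))
  (λ {j} j∈ → Equivalence.to (pat i j) (Equivalence.to (sameBlock-kernel f {i} {j}) j∈))

-- Monochromatic graphs and refinement of the kernel.

Monochromatic : Coloring n → Pred (Graph n) _
Monochromatic f g = All (λ (u , v) → lookup f u ≡ lookup f v) (edges g)

monochromatic? : (f : Coloring n) → Decidable (Monochromatic f)
monochromatic? f g = All.all? (λ (u , v) → lookup f u ≟ℙ lookup f v) (edges g)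

-- The ends of an edge lie in one component. Conversely, having equal colors is an equivalence
-- relation, so if it holds along every edge, it holds along every path.
components≤kernel : (g : Graph n) (f : Coloring n) →
                    components g ≤ kernel f ⇔ Monochromatic f g
components≤kernel g f = mk⇔ to from
  where
  to : components g ≤ kernel f → Monochromatic f g
  to le = All.tabulate λ {(u , v)} uv∈ → Equivalence.to (sameBlock-kernel f {u} {v})
    (le u (Equivalence.from (sameBlock-components g {u} {v}) (fwd uv∈ ◅ ε)))

  from : Monochromatic f g → components g ≤ kernel f
  from mono i {j} j∈ = Equivalence.from (sameBlock-kernel f {i} {j})
    (EqC.gfold ≡.isEquivalence (lookup f) (All.lookup mono)
      (Equivalence.to (sameBlock-components g {i} {j}) j∈))

module _ (G : Plurigraph n) (f : Coloring n) where

  private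
    G⟨_⟩ : Fin (size G) → Graph n
    G⟨ i ⟩ = List.lookup (graphs G) i

  monochromatics : Subset (size G)
  monochromatics = ⟦ (λ i → monochromatic? f G⟨ i ⟩) ⟧

  ∈monochromatics : ∀ {i} → i ∈ monochromatics ⇔ Monochromatic f G⟨ i ⟩
  ∈monochromatics = ∈⟦⟧⇔ (λ i → monochromatic? f G⟨ i ⟩)

  -- The edges of the union are exactly the edges of the members selected by `A`.
  monochromatic-union : (A : Subset (size G)) →
                        Monochromatic f (union G A) ⇔ A ⊆ monochromatics
  monochromatic-union A = mk⇔
    (λ mono {i} i∈A → Equivalence.from ∈monochromatics (All.tabulate λ e∈ →
      All.lookup mono (∈-concatMap⁺ (edges ∘ G⟨_⟩)
        (lose (∈-filter⁺ _ (∈-allFin i) i∈A) e∈))))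
    (λ A⊆ → All.tabulate λ e∈ →
      let i , i∈ , e∈i = find (∈-concatMap⁻ (edges ∘ G⟨_⟩) e∈)
      in All.lookup (Equivalence.to ∈monochromatics
           (A⊆ (proj₂ (∈-filter⁻ _ {xs = List.allFin (size G)} i∈)))) e∈i)

  π≤kernel : (A : Subset (size G)) → π G A ≤ kernel f ⇔ A ⊆ monochromatics
  π≤kernel A = monochromatic-union A ⇔-∘ components≤kernel (union G A) f

  -- Equality of colors is decidable, so a graph that is not monochromatic yields an actual edge
  -- with two colors.
  proper⇔noMonochromatic : Proper G f ⇔ Empty monochromatics
  proper⇔noMonochromatic = mk⇔
    (λ proper (i , i∈) →
      Any¬⇒¬All (All.lookup proper (∈-lookup i)) (Equivalence.to ∈monochromatics i∈))
    (λ empty → All.tabulate λ {g} g∈ →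
      ¬All⇒Any¬ (λ (u , v) → lookup f u ≟ℙ lookup f v) (edges g) λ mono →
        empty (Any.index g∈ , Equivalence.from ∈monochromatics
          (subst (Monochromatic f) (lookup-index g∈) mono)))

-- Finite sums in a commutative ring.

module ListSum {r₁ r₂} (R : CommutativeRing r₁ r₂) where

  open CommutativeRing R
    renaming (refl to ≈-refl; sym to ≈-sym; trans to ≈-trans; zero to *-zero)
  open Exp semiring using (_^_)
  open RingProperties ring using (-1*x≈-x; -‿distribˡ-*; -0#≈0#; -‿+-comm)
  open import Relation.Binary.Reasoning.Setoid setoid

  sum : List A → (A → Carrier) → Carrier
  sum xs F = List.foldr _+_ 0# (List.map F xs)

  𝟙 : Bool → Carrier
  𝟙 x = if x then 1# else 0#

  𝟙-cong : {x y : Bool} → x ≡ y → 𝟙 x ≈ 𝟙 y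
  𝟙-cong = reflexive ∘ cong 𝟙

  sum-cong : (xs : List A) {F F′ : A → Carrier} →
             (∀ x → F x ≈ F′ x) → sum xs F ≈ sum xs F′
  sum-cong []       eq = ≈-refl
  sum-cong (x ∷ xs) eq = +-cong (eq x) (sum-cong xs eq)

  sum-zero : {xs : List A} {F : A → Carrier} →
             All (λ x → F x ≈ 0#) xs → sum xs F ≈ 0#
  sum-zero []         = ≈-refl
  sum-zero (eq ∷ eqs) = ≈-trans (+-cong eq (sum-zero eqs)) (+-identityˡ 0#)

  sum-neg : (xs : List A) {F : A → Carrier} → sum xs (λ x → - F x) ≈ - sum xs F
  sum-neg []       = ≈-sym -0#≈0#
  sum-neg (x ∷ xs) = ≈-trans (+-congˡ (sum-neg xs)) (-‿+-comm _ _)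

  sum-++ : (xs ys : List A) {F : A → Carrier} →
           sum (xs ++ ys) F ≈ sum xs F + sum ys F
  sum-++ []       ys = ≈-sym (+-identityˡ _)
  sum-++ (x ∷ xs) ys = ≈-trans (+-congˡ (sum-++ xs ys)) (≈-sym (+-assoc _ _ _))

  sum-map : (h : A → B) (xs : List A) {F : B → Carrier} →
            sum (List.map h xs) F ≈ sum xs (F ∘ h)
  sum-map h []       = ≈-refl
  sum-map h (x ∷ xs) = +-congˡ (sum-map h xs)

  -- This moves a sum over `setPartitions` to the list of all candidate block vectors, with 0 for a
  -- candidate that is not a partition.
  sum-mapMaybe : (h : A → Maybe B) (xs : List A) {F : B → Carrier} →
                 sum (List.mapMaybe h xs) F ≈ sum xs (maybe′ F 0# ∘ h)
  sum-mapMaybe h []       = ≈-refl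
  sum-mapMaybe h (x ∷ xs) with h x
  ... | nothing = ≈-trans (sum-mapMaybe h xs) (≈-sym (+-identityˡ _))
  ... | just y  = +-congˡ (sum-mapMaybe h xs)

  sum-filter : {P : Pred A ℓ} (P? : Decidable P) (xs : List A) {F : A → Carrier} →
               sum (List.filter P? xs) F ≈ sum xs (λ x → if does (P? x) then F x else 0#)
  sum-filter P? []       = ≈-refl
  sum-filter P? (x ∷ xs) with does (P? x)
  ... | false = ≈-trans (sum-filter P? xs) (≈-sym (+-identityˡ _))
  ... | true  = +-congˡ (sum-filter P? xs)

  -- Uniqueness rules out a second occurrence of `k`, which would count `F k` twice.
  sum-single : {xs : List A} {F : A → Carrier} {k : A} → Unique xs → k ∈ˡ xs →
               (∀ {x} → x ≢ k → F x ≈ 0#) → sum xs F ≈ F k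
  sum-single (k≢ ∷ xs!) (here refl) vanish =
    ≈-trans (+-congˡ (sum-zero (All.map (λ k≢x → vanish (k≢x ∘ sym)) k≢)))
            (+-identityʳ _)
  sum-single (x≢ ∷ xs!) (there k∈) vanish =
    ≈-trans (+-cong (vanish (All.lookup x≢ k∈)) (sum-single xs! k∈ vanish))
            (+-identityˡ _)

  -- Alternating sums over subsets.

  sum-subsets : (k : ℕ) {F : Subset (suc k) → Carrier} →
    sum (subsets (suc k)) F ≈
    sum (subsets k) (F ∘ (outside ∷_)) + sum (subsets k) (F ∘ (inside ∷_))
  sum-subsets k {F} = begin
    -- The trailing `[]` is what `concatMap` leaves after the two letters `outside` and `inside`.
    sum (outs ++ ins ++ []) F      ≈⟨ sum-++ outs (ins ++ []) ⟩
    sum outs F + sum (ins ++ []) F ≡⟨ cong (λ xs → sum outs F + sum xs F) (++-identityʳ ins) ⟩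
    sum outs F + sum ins F         ≈⟨ +-cong (sum-map _ (subsets k)) (sum-map _ (subsets k)) ⟩
    sum (subsets k) (F ∘ (outside ∷_)) + sum (subsets k) (F ∘ (inside ∷_)) ∎
    where
    outs = List.map (outside ∷_) (subsets k)
    ins  = List.map (inside ∷_) (subsets k)

  -- Induction on the ground set. If its first element is outside `S`, the subsets containing it
  -- contribute 0 and the sum is the one for `k`. If it is in `S`, adding it to a subset reverses
  -- the sign, and everything cancels in pairs.
  alternating-sum : (k : ℕ) (S : Subset k) →
    sum (subsets k) (λ A → (- 1#) ^ ∣ A ∣ * 𝟙 (does (A ⊆? S))) ≈
    𝟙 (does (¬? (nonempty? S)))
  alternating-sum zero [] = ≈-trans (+-identityʳ _) (*-identityˡ 1#)
  alternating-sum (suc k) (outside ∷ S) = begin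
    _
      ≈⟨ sum-subsets k ⟩
    sum (subsets k) (λ A → (- 1#) ^ ∣ A ∣ * 𝟙 (does (outside ∷ A ⊆? outside ∷ S))) +
    sum (subsets k) (λ A → (- 1#) ^ ∣ inside ∷ A ∣ * 𝟙 (does (inside ∷ A ⊆? outside ∷ S)))
      ≈⟨ +-cong
           (sum-cong (subsets k) λ A → *-congˡ
             (𝟙-cong (does-⇔ (⇔-sym out⊆-⇔) (outside ∷ A ⊆? outside ∷ S) (A ⊆? S))))
           (sum-zero {xs = subsets k} (All.tabulate λ {A} _ → ≈-trans
             (*-congˡ (𝟙-cong (dec-false (inside ∷ A ⊆? outside ∷ S) in⊈out)))
             (zeroʳ _))) ⟩
    sum (subsets k) (λ A → (- 1#) ^ ∣ A ∣ * 𝟙 (does (A ⊆? S))) + 0#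
      ≈⟨ +-identityʳ _ ⟩
    sum (subsets k) (λ A → (- 1#) ^ ∣ A ∣ * 𝟙 (does (A ⊆? S)))
      ≈⟨ alternating-sum k S ⟩
    𝟙 (does (¬? (nonempty? S)))
      ≈⟨ 𝟙-cong (does-⇔ empty-out (¬? (nonempty? S)) (¬? (nonempty? (outside ∷ S)))) ⟩
    𝟙 (does (¬? (nonempty? (outside ∷ S)))) ∎
    where
    in⊈out : {A : Subset k} → ¬ (inside ∷ A ⊆ outside ∷ S)
    in⊈out le with () ← le Vec.here

    empty-out : Empty S ⇔ Empty (outside ∷ S)
    empty-out = mk⇔
      (λ { empty (suc i , i∈) → empty (i , drop-there i∈) })
      (λ empty (i , i∈) → empty (suc i , Vec.there i∈))
  alternating-sum (suc k) (inside ∷ S) = begin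
    _
      ≈⟨ sum-subsets k ⟩
    sum (subsets k) (λ A → (- 1#) ^ ∣ A ∣ * 𝟙 (does (outside ∷ A ⊆? inside ∷ S))) +
    sum (subsets k) (λ A → (- 1#) ^ ∣ inside ∷ A ∣ * 𝟙 (does (inside ∷ A ⊆? inside ∷ S)))
      ≈⟨ +-cong
           (sum-cong (subsets k) λ A → *-congˡ
             (𝟙-cong (does-⇔ (⇔-sym out⊆-⇔) (outside ∷ A ⊆? inside ∷ S) (A ⊆? S))))
           (sum-cong (subsets k) λ A → ≈-trans
             -- The cardinality of `inside ∷ A` is a successor, so the power unfolds to `- 1#` times
             -- the power for `A`.
             (*-cong (-1*x≈-x _)
               (𝟙-cong (does-⇔ (⇔-sym in⊆in-⇔) (inside ∷ A ⊆? inside ∷ S) (A ⊆? S))))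
             (≈-sym (-‿distribˡ-* _ _))) ⟩
    sum (subsets k) F + sum (subsets k) (λ A → - F A)
      ≈⟨ +-congˡ (sum-neg (subsets k)) ⟩
    sum (subsets k) F - sum (subsets k) F
      ≈⟨ -‿inverseʳ _ ⟩
    0#
      ≈⟨ 𝟙-cong (dec-false (¬? (nonempty? (inside ∷ S))) λ empty → empty (zero , Vec.here)) ⟨
    𝟙 (does (¬? (nonempty? (inside ∷ S)))) ∎
    where
    F : Subset k → Carrier
    F A = (- 1#) ^ ∣ A ∣ * 𝟙 (does (A ⊆? S))

-- Coefficients of the series at a word.

occurs-toList : {P : Pred (Coloring n) ℓ} {f : Coloring n} → Occurs P (toList f) ⇔ P f
occurs-toList {P = P} {f} = mk⇔
  -- `toList` is injective on vectors of one length, so `g` is `f`.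
  (λ (g , Pg , eq) → subst P
    (trans (sym (Vec.cast-is-id refl g)) (Vec.toList-injective refl g f eq)) Pg)
  (λ Pf → f , Pf , refl)

module Coefficients {c ℓ₁ ℓ₂} (K : HeytingField c ℓ₁ ℓ₂) where

  open Over K
  private
    commutativeRing : CommutativeRing c ℓ₁
    commutativeRing = HeytingCommutativeRing.commutativeRing
                        (HeytingField.heytingCommutativeRing K)
  open CommutativeRing commutativeRing
    renaming (refl to ≈-refl; sym to ≈-sym; trans to ≈-trans; zero to *-zero)
  open ListSum commutativeRing
  open import Relation.Binary.Reasoning.Setoid setoid

  ∑y-toList : {P : Pred (Coloring n) ℓ} (P? : Decidable P) (f : Coloring n) →
              ∑y P? (toList f) ≈ 𝟙 (does (P? f))
  ∑y-toList P? f = 𝟙-cong (does-⇔ occurs-toList (occurs? P? (toList f)) (P? f))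

  ∑y-length : {P : Pred (Coloring n) ℓ} (P? : Decidable P) (w : List ℙ) →
              List.length w ≢ n → ∑y P? w ≈ 0#
  ∑y-length P? w len≢n = 𝟙-cong (dec-false (occurs? P? w)
    λ { (f , _ , refl) → len≢n (Vec.length-toList f) })

  -- The sum is carried to all vectors of subsets, where repetitions are excluded and equality
  -- concerns blocks alone. There only the vector of blocks of the kernel can contribute.
  p-toList : (π : SetPartition n) (f : Coloring n) →
             p π (toList f) ≈ 𝟙 (does (π ≤? kernel f))
  p-toList {n} π f = begin
    p π (toList f)
      ≈⟨ sum-filter (π ≤?_) (setPartitions n) ⟩
    sum (setPartitions n) coeff
      ≈⟨ sum-mapMaybe fromBlocks (vectors (subsets n) n) ⟩
    sum (vectors (subsets n) n) (maybe′ coeff 0# ∘ fromBlocks)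
      ≈⟨ sum-single (vectors-unique (subsets-unique n) n)
           (∈-vectors ∈-subsets (blocks (kernel f))) vanish ⟩
    maybe′ coeff 0# (fromBlocks (blocks (kernel f)))
      ≈⟨ at-kernel ⟩
    𝟙 (does (π ≤? kernel f)) ∎
    where
    fromBlocks : Vec (Subset n) n → Maybe (SetPartition n)
    fromBlocks bs = Maybe.map (setPartition bs) (dec⇒maybe (isSetPartition? bs))

    coeff : SetPartition n → Carrier
    coeff σ = if does (π ≤? σ) then m σ (toList f) else 0#

    vanish : ∀ {bs} → bs ≢ blocks (kernel f) → maybe′ coeff 0# (fromBlocks bs) ≈ 0#
    vanish {bs} bs≢ with isSetPartition? bs
    ... | no _  = ≈-refl
    ... | yes q with does (π ≤? setPartition bs q)
    ...   | false = ≈-refl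
    ...   | true  = ≈-trans (∑y-toList (hasPattern? (setPartition bs q)) f)
      (𝟙-cong (dec-false (hasPattern? (setPartition bs q) f)
        (bs≢ ∘ hasPattern⇒kernel (setPartition bs q) f)))

    at-kernel : maybe′ coeff 0# (fromBlocks (blocks (kernel f))) ≈ 𝟙 (does (π ≤? kernel f))
    at-kernel with isSetPartition? (blocks (kernel f))
    ... | no ¬q = contradiction (isSetPartition (kernel f)) ¬q
    -- `q` need not be the proof stored in `kernel f`, but `_≤_` and `HasPattern` look only at the
    -- blocks.
    ... | yes q with does (π ≤? kernel f)
    ...   | false = ≈-refl
    ...   | true  = ≈-trans (∑y-toList (hasPattern? (setPartition (blocks (kernel f)) q)) f)
      (𝟙-cong (dec-true (hasPattern? (setPartition (blocks (kernel f)) q) f) (hasPattern-kernel f)))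

  p-length : (π : SetPartition n) (w : List ℙ) → List.length w ≢ n → p π w ≈ 0#
  p-length {n} π w len≢n = sum-zero {xs = List.filter (π ≤?_) (setPartitions n)}
    (All.tabulate λ {σ} _ → ∑y-length (hasPattern? σ) w len≢n)

  Y-toList : (G : Plurigraph n) (f : Coloring n) → Y G (toList f) ≈
    ∑ (subsets (size G)) (λ A → ((- 1#) ^ ∣ A ∣) · p (π G A)) (toList f)
  Y-toList G f = begin
    Y G (toList f)
      ≈⟨ ∑y-toList (proper? G) f ⟩
    𝟙 (does (proper? G f))
      ≈⟨ 𝟙-cong (does-⇔ (proper⇔noMonochromatic G f) (proper? G f) (¬? (nonempty? S))) ⟩
    𝟙 (does (¬? (nonempty? S)))
      ≈⟨ alternating-sum (size G) S ⟨
    sum (subsets (size G)) (λ A → (- 1#) ^ ∣ A ∣ * 𝟙 (does (A ⊆? S)))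
      ≈⟨ sum-cong (subsets (size G)) (λ A → *-congˡ (≈-trans (p-toList (π G A) f)
           (𝟙-cong (does-⇔ (π≤kernel G f A) (π G A ≤? kernel f) (A ⊆? S))))) ⟨
    sum (subsets (size G)) (λ A → (- 1#) ^ ∣ A ∣ * p (π G A) (toList f)) ∎
    where
    S : Subset (size G)
    S = monochromatics G f

  -- A series has coefficients at words of every length. Words of length `n` are words of colorings;
  -- at all others both sides vanish, because every monomial involved has degree `n`.
  Y-expansion : (G : Plurigraph n) →
                Y G ≋ ∑ (subsets (size G)) (λ A → ((- 1#) ^ ∣ A ∣) · p (π G A))
  Y-expansion {n} G w = byLength (List.length w ℕ.≟ n)
    where
    RHS : Series
    RHS = ∑ (subsets (size G)) (λ A → ((- 1#) ^ ∣ A ∣) · p (π G A))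

    byLength : Dec (List.length w ≡ n) → Y G w ≈ RHS w
    byLength (yes refl) =
      subst (λ u → Y G u ≈ RHS u) (Vec.toList∘fromList w) (Y-toList G (fromList w))
    byLength (no len≢n) = ≈-trans (∑y-length (proper? G) w len≢n) (≈-sym
      (sum-zero {xs = subsets (size G)} (All.tabulate λ {A} _ →
        ≈-trans (*-congˡ (p-length (π G A) w len≢n)) (zeroʳ _))))

theorem2p6 : ∀ {c ℓ₁ ℓ₂} (K : HeytingField c ℓ₁ ℓ₂) →
    let open HeytingField K
        open Over K
    in CharacteristicZero →
       ∀ (n : ℕ) (G : Plurigraph n) →
       Y G ≋ ∑ (subsets (size G)) (λ A → ((- 1#) ^ ∣ A ∣) · p (π G A))
theorem2p6 K _ n = Coefficients.Y-expansion K
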